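{- Let $G$ be a finite chordal graph (connected) and $\ell\ge 0$. Then $c'_\ell(G)=c_\ell(G)$. Furthermore, in the $\ell$-visibility game on $G$, once some cop is within distance $\ell$ of the robber, that cop (alone) can capture the robber.
   Context: $\ell$-visibility Cops and Robber on a graph $G$: in round 0 a set of cops each choose a vertex, then a single robber chooses a vertex. In each subsequent round, every cop moves to a neighbouring vertex or stays put, and then the robber moves to a neighbouring vertex or stays put. The robber always knows the positions of all cops. The cops know the robber's position only at moments when some cop and the robber occupy vertices $x,y$ with $d(x,y)\le \ell$ (the cops then see the robber). The cops capture the robber if a cop occupies the robber's vertex. $c_\ell(G)$ is the minimum number of cops that can guarantee capture; $c'_\ell(G)$ is the minimum number of cops that can guarantee that at some moment some cop is within distance $\ell$ of the robber. A graph is chordal if it has no induced cycle of length at least $4$. -}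

module Defs where

open import Data.Nat using (ℕ; zero; suc; _+_; _<_; _≤_; _%_)
open import Data.Bool using (Bool; true; false; _∨_; _∧_; if_then_else_)
open import Data.Fin using (Fin; toℕ; _≟_)
import Data.Fin as F
open import Data.Maybe using (Maybe; just; nothing)
open import Data.List using (List; []; _∷_)
open import Data.Product using (Σ; ∃; _×_; _,_)
open import Data.Sum using (_⊎_)
open import Relation.Nullary using (¬_)
open import Relation.Nullary.Decidable using (⌊_⌋)
open import Relation.Binary.PropositionalEquality using (_≡_)
open import Function.Definitions using (Injective)
open import Function.Bundles using (_⇔_)

record Graph : Set where
  field
    n      : ℕ
    adj    : Fin n → Fin n → Bool
    sym    : ∀ x y → adj x y ≡ adj y x
    irrefl : ∀ x → adj x x ≡ false

module _ (G : Graph) where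
  open Graph G

  V : Set
  V = Fin n

  Step : V → V → Set
  Step x y = (x ≡ y) ⊎ (adj x y ≡ true)

  stepB : V → V → Bool
  stepB x y = ⌊ x ≟ y ⌋ ∨ adj x y

  anyFin : ∀ {m} → (Fin m → Bool) → Bool
  anyFin {zero}  f = false
  anyFin {suc m} f = f F.zero ∨ anyFin (λ i → f (F.suc i))

  -- within k x y = true  iff  there is a walk of length ≤ k from x to y,
  -- i.e. iff  d(x , y) ≤ k   (lazy walks of exactly k steps)
  within : ℕ → V → V → Bool
  within zero    x y = ⌊ x ≟ y ⌋
  within (suc k) x y = anyFin (λ z → stepB x z ∧ within k z y)

  Dist≤ : ℕ → V → V → Set
  Dist≤ k x y = within k x y ≡ true

  Connected : Set
  Connected = ∀ x y → ∃ λ k → Dist≤ k x y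

  IsInducedCycle : (j : ℕ) → (Fin (4 + j) → V) → Set
  IsInducedCycle j c =
    Injective _≡_ _≡_ c ×
    (∀ a b → (adj (c a) (c b) ≡ true) ⇔
             ((toℕ b ≡ (toℕ a + 1) % (4 + j)) ⊎ (toℕ a ≡ (toℕ b + 1) % (4 + j))))

  Chordal : Set
  Chordal = ∀ j (c : Fin (4 + j) → V) → ¬ IsInducedCycle j c

  Conf : ℕ → Set
  Conf k = Fin k → V

  observe : ℕ → ∀ {k} → Conf k → V → Maybe V
  observe ℓ C r = if anyFin (λ i → within ℓ (C i) r) then just r else nothing

  -- Cops' strategy: initial placement; each move depends on the cops'
  -- current positions and on the whole history of observations
  -- (most recent first), which is all the cops know.
  record CopStrategy (k : ℕ) : Set where
    field
      start : Conf k
      move  : List (Maybe V) → Conf k → Conf k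
      legal : ∀ h C i → Step (C i) (move h C i)

  -- Robber's strategy: the robber knows everything; its placement depends on
  -- the cops' placement, each move on the full history of cop positions
  -- (most recent first, including the cops' current move) and its own position.
  record RobberStrategy (k : ℕ) : Set where
    field
      start : Conf k → V
      move  : List (Conf k) → V → V
      legal : ∀ h r → Step r (move h r)

  -- state at the end of a round (after the robber's move; cops to move)
  record State (k : ℕ) : Set where
    constructor st
    field
      cops  : Conf k
      rob   : V
      copH  : List (Maybe V)
      robH  : List (Conf k)

  module Play (ℓ : ℕ) {k : ℕ} (σ : CopStrategy k) (ρ : RobberStrategy k) where
    private
      module σ = CopStrategy σ
      module ρ = RobberStrategy ρ

    round : State k → State k
    round (st C R ch rh) =
      let C'  = σ.move ch C
          ch' = observe ℓ C' R ∷ ch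
          rh' = C' ∷ rh
          R'  = ρ.move rh' R
      in st C' R' (observe ℓ C' R' ∷ ch') rh'

    run : State k → ℕ → State k
    run s zero    = s
    run s (suc t) = round (run s t)

    init : State k
    init = let C0 = σ.start ; R0 = ρ.start C0
           in st C0 R0 (observe ℓ C0 R0 ∷ []) (C0 ∷ [])

    -- some moment (after a robber move or after the following cop move) at
    -- which some cop and the robber satisfy the relation P
    Eventually : (V → V → Set) → State k → Set
    Eventually P s = ∃ λ t → ∃ λ i →
      P (State.cops (run s t) i) (State.rob (run s t)) ⊎
      P (State.cops (run s (suc t)) i) (State.rob (run s t))

  CanCapture : ℕ → ℕ → Set
  CanCapture ℓ k = Σ (CopStrategy k) λ σ → ∀ (ρ : RobberStrategy k) →
    Play.Eventually ℓ σ ρ _≡_ (Play.init ℓ σ ρ)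

  CanSee : ℕ → ℕ → Set
  CanSee ℓ k = Σ (CopStrategy k) λ σ → ∀ (ρ : RobberStrategy k) →
    Play.Eventually ℓ σ ρ (Dist≤ ℓ) (Play.init ℓ σ ρ)

  IsLeast : (ℕ → Set) → ℕ → Set
  IsLeast P m = P m × (∀ j → j < m → ¬ P j)

  OneCopCapturesCopsTurn : ℕ → V → V → Set
  OneCopCapturesCopsTurn ℓ u r = Σ (CopStrategy 1) λ σ → ∀ (ρ : RobberStrategy 1) →
    Play.Eventually ℓ σ ρ _≡_
      (st (λ _ → u) r (observe ℓ {1} (λ _ → u) r ∷ []) ((λ _ → u) ∷ []))

  -- one cop at u, robber at r; the robber is to move (the cop has just moved
  -- to u and seen the robber).  Captured if u = r, or otherwise after the
  -- robber's move the play continues from the resulting end-of-round state.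
  OneCopCapturesRobbersTurn : ℕ → V → V → Set
  OneCopCapturesRobbersTurn ℓ u r = Σ (CopStrategy 1) λ σ → ∀ (ρ : RobberStrategy 1) →
    (u ≡ r) ⊎
    Play.Eventually ℓ σ ρ _≡_
      (st (λ _ → u) (RobberStrategy.move ρ ((λ _ → u) ∷ []) r)
          (observe ℓ {1} (λ _ → u) (RobberStrategy.move ρ ((λ _ → u) ∷ []) r)
            ∷ observe ℓ {1} (λ _ → u) r ∷ [])
          ((λ _ → u) ∷ []))

{-# OPTIONS --safe #-}
module Submission where

-- Pursuit.  Whenever a cop is within ℓ of the robber on the robber's turn, it knows on its own
-- turn either the robber's position r or the position s that r was reached from, and r is then
-- at distance ℓ + 1.  In both cases it can move from u to some u′ closer to r, so it never loses
-- track.  If K is the component of G − N[u] containing r, the neighbours of u bordering K form a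
-- clique by chordality, and u′ is one of them: the robber is either next to u′ or confined to a
-- strictly smaller component of G − N[u′].
--
-- Existence of the minimum.  This is constructive, so it needs "k cops can see" to be decidable.
-- Before the first sighting the cops get no information and play a fixed schedule; the pair
-- (possible robber positions, cop positions) then evolves in a finite graph, in which reaching
-- the empty set of positions is decidable.  That a winning schedule clears the graph by some
-- fixed time is a fan theorem, provable without choice because the number of robber positions
-- is bounded.

open import Defs
open import Data.Bool using (Bool; true; false; _∧_) renaming (_≟_ to _≟ᵇ_)
open import Data.Empty using (⊥)
open import Data.Fin using (Fin; zero; suc; toℕ; _≟_; combine; remQuot; finToFun; funToFin)
open import Data.Fin.Properties using (any?; all?; remQuot-combine; finToFun-funToFin; toℕ<n)
open import Data.List using (List; []; _∷_; length; allFin)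
open import Data.List.Membership.Propositional.Properties using (∈-allFin)
open import Data.List.Relation.Unary.All as List using ([]; _∷_)
open import Data.Maybe using (Maybe; just; nothing)
open import Data.Nat using (ℕ; zero; suc; _+_; _*_; _^_; _%_; _⊔_; _<_; _≤_; z≤n; s≤s; pred; ⌊_/2⌋)
open import Data.Nat.DivMod using (m<n⇒m%n≡m; n%n≡0)
open import Data.Nat.Properties using (≤-refl; ≤-trans; ≤-reflexive; <-≤-trans; m≤n⇒m≤1+n; n≮0;
  m≤m+n; m≤m⊔n; m≤n⊔m; +-comm; suc-injective; ≤-pred; ≤∧≢⇒<;
  m<1+n⇒m<n∨m≡n; +-suc; +-identityʳ; _≤?_; ≰⇒>) renaming (_≟_ to _≟ℕ_)
open import Data.Product using (Σ; ∃; _×_; _,_; proj₁; proj₂)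
open import Data.Sum using (_⊎_; inj₁; inj₂; swap) renaming (map to ⊎-map)
open import Data.Unit using (⊤; tt)
open import Data.Vec using (Vec; []; _∷_; lookup)
open import Data.Vec.Relation.Unary.All using (All; []; _∷_)
open import Data.Vec.Relation.Unary.All.Properties using (lookup⁺)
open import Data.Vec.Relation.Unary.Any using (Any; here; there) renaming (any? to anyᵛ?)
open import Function using (id)
open import Function.Bundles using (mk⇔)
open import Relation.Binary.Construct.Closure.ReflexiveTransitive using (Star; ε; _◅_; _◅◅_; reverse)
open import Relation.Binary.Definitions using (Decidable)
open import Relation.Binary.PropositionalEquality using (_≡_; _≢_; refl; sym; trans; cong; cong₂; subst; subst₂)
open import Relation.Nullary using (¬_; Dec; yes; no; contradiction)
open import Relation.Nullary.Decidable using (¬?; _×-dec_; _⊎-dec_; _→-dec_; map′; decidable-stable)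

-- Counting and reachability on finite sets

bump : {P : Set} → Dec P → ℕ → ℕ
bump (yes _) c = suc c
bump (no _)  c = c

count : ∀ {m} {P : Fin m → Set} → (∀ i → Dec (P i)) → ℕ
count {zero}  P? = 0
count {suc m} P? = bump (P? zero) (count (λ i → P? (suc i)))

count-⊆ : ∀ {m} {P Q : Fin m → Set} (P? : ∀ i → Dec (P i)) (Q? : ∀ i → Dec (Q i)) →
          (∀ i → P i → Q i) → count P? ≤ count Q?
count-⊆ {zero}  P? Q? P⊆Q = z≤n
count-⊆ {suc m} P? Q? P⊆Q with P? zero | Q? zero
... | yes p | yes q = s≤s (count-⊆ (λ i → P? (suc i)) (λ i → Q? (suc i)) (λ i → P⊆Q (suc i)))
... | yes p | no ¬q = contradiction (P⊆Q zero p) ¬q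
... | no ¬p | yes q = m≤n⇒m≤1+n (count-⊆ (λ i → P? (suc i)) (λ i → Q? (suc i)) (λ i → P⊆Q (suc i)))
... | no ¬p | no ¬q = count-⊆ (λ i → P? (suc i)) (λ i → Q? (suc i)) (λ i → P⊆Q (suc i))

count-⊂ : ∀ {m} {P Q : Fin m → Set} (P? : ∀ i → Dec (P i)) (Q? : ∀ i → Dec (Q i)) →
          (∀ i → P i → Q i) → ∀ i → Q i → ¬ P i → count P? < count Q?
count-⊂ {suc m} P? Q? P⊆Q zero q₀ ¬p₀ with P? zero | Q? zero
... | yes p | _     = contradiction p ¬p₀
... | no _  | no ¬q = contradiction q₀ ¬q
... | no _  | yes _ = s≤s (count-⊆ (λ i → P? (suc i)) (λ i → Q? (suc i)) (λ i → P⊆Q (suc i)))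
count-⊂ {suc m} P? Q? P⊆Q (suc i) qᵢ ¬pᵢ
  with P? zero | Q? zero
     | count-⊂ (λ i → P? (suc i)) (λ i → Q? (suc i)) (λ i → P⊆Q (suc i)) i qᵢ ¬pᵢ
... | yes p | yes q | lt = s≤s lt
... | yes p | no ¬q | lt = contradiction (P⊆Q zero p) ¬q
... | no ¬p | yes q | lt = m≤n⇒m≤1+n lt
... | no ¬p | no ¬q | lt = lt

count-empty : ∀ {m} {P : Fin m → Set} (P? : ∀ i → Dec (P i)) → (∀ i → ¬ P i) → count P? ≡ 0
count-empty {zero}  P? ¬P = refl
count-empty {suc m} P? ¬P with P? zero
... | yes p = contradiction p (¬P zero)
... | no _  = count-empty (λ i → P? (suc i)) (λ i → ¬P (suc i))

count≤0⇒empty : ∀ {m} {P : Fin m → Set} (P? : ∀ i → Dec (P i)) → count P? ≤ 0 → ∀ i → ¬ P i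
count≤0⇒empty P? c≤0 i p =
  n≮0 (<-≤-trans (count-⊂ {P = λ _ → ⊥} (λ _ → no id) P? (λ _ ()) i p id) c≤0)

count≤size : ∀ {m} {P : Fin m → Set} (P? : ∀ i → Dec (P i)) → count P? ≤ m
count≤size {zero}  P? = z≤n
count≤size {suc m} P? with P? zero
... | yes _ = s≤s (count≤size (λ i → P? (suc i)))
... | no _  = m≤n⇒m≤1+n (count≤size (λ i → P? (suc i)))

uniform-bound : ∀ {m} (P : Fin m → ℕ → Set) → (∀ i {s t} → s ≤ t → P i s → P i t) →
                (∀ i → ∃ (P i)) → ∃ λ t → ∀ i → P i t
uniform-bound {zero}  P mono bound = 0 , λ ()
uniform-bound {suc m} P mono bound
  with bound zero | uniform-bound (λ i → P (suc i)) (λ i → mono (suc i)) (λ i → bound (suc i))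
... | s , p | t , ps = s ⊔ t , λ where
  zero    → mono zero (m≤m⊔n s t) p
  (suc i) → mono (suc i) (m≤n⊔m s t) (ps i)

module _ {N : ℕ} {R : Fin N → Fin N → Set} (R? : Decidable R) where

  -- Backward closure: `S` holds vertices already known to reach `y`, and it grows by one
  -- predecessor at a time. `m` bounds the number of vertices outside `S`, so this stops; an `S`
  -- that no predecessor can enlarge contains everything that reaches `y`.
  saturate : ∀ y m (S : Fin N → Set) (S? : ∀ x → Dec (S x)) → count (λ x → ¬? (S? x)) ≤ m →
             (∀ x → S x → Star R x y) → S y → ∀ x → Dec (Star R x y)
  saturate y m S S? size sound Sy with any? (λ v → ¬? (S? v) ×-dec any? (λ w → S? w ×-dec R? v w))
  ... | no closed = λ x → map′ (sound x) complete (S? x)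
    where
    complete : ∀ {x} → Star R x y → S x
    complete ε = Sy
    complete {x} (r ◅ rs) = decidable-stable (S? x) (λ ¬Sx → closed (x , ¬Sx , _ , complete rs , r))
  saturate y zero S S? size sound Sy | yes (v , ¬Sv , _) =
    contradiction ¬Sv (count≤0⇒empty (λ x → ¬? (S? x)) size v)
  saturate y (suc m) S S? size sound Sy | yes (v , ¬Sv , w , Sw , r) =
    saturate y m (λ x → S x ⊎ x ≡ v) S′?
      (≤-pred (≤-trans (count-⊂ (λ x → ¬? (S′? x)) (λ x → ¬? (S? x)) (λ x ¬S′ s → ¬S′ (inj₁ s))
                         v ¬Sv (λ ¬S′ → ¬S′ (inj₂ refl))) size))
      (λ { x (inj₁ s) → sound x s ; x (inj₂ refl) → r ◅ sound w Sw }) (inj₁ Sy)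
    where
    S′? : ∀ x → Dec (S x ⊎ x ≡ v)
    S′? x = S? x ⊎-dec (x ≟ v)

  star? : Decidable (Star R)
  star? x y = saturate y N (_≡ y) (_≟ y) (count≤size _) (λ { _ refl → ε }) refl x

-- Walks through a set that varies with time, and a fan theorem.

module Walks {n : ℕ} (_⇝_ : Fin n → Fin n → Set) (_⇝?_ : Decidable _⇝_) (⇝-refl : ∀ {x} → x ⇝ x) where

  shift : (ℕ → Fin n → Set) → ℕ → Fin n → Set
  shift A t = A (suc t)

  -- `A t` is the set of vertices allowed at time `t`. In the application these are the vertices
  -- where the robber stays unseen in round `t`.
  Reach : (ℕ → Fin n → Set) → ℕ → Fin n → Fin n → Set
  Reach A zero    x v = A 0 x × x ≡ v
  Reach A (suc t) x v = (∃ λ z → Reach A t x z × z ⇝ v) × A (suc t) v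

  Alive : (ℕ → Fin n → Set) → ℕ → Fin n → Set
  Alive A t x = ∃ (Reach A t x)

  Mortal : (ℕ → Fin n → Set) → Fin n → Set
  Mortal A x = ∃ λ t → ¬ Alive A t x

  -- `Mortal` bounds all allowed walks from `x` at once, whereas here each infinite walk leaves `A`
  -- at a time of its own. Passing from the second notion to the first is the fan theorem.
  Escapeless : (ℕ → Fin n → Set) → Fin n → Set
  Escapeless A x = ∀ (α : ℕ → Fin n) → α 0 ≡ x → (∀ t → α t ⇝ α (suc t)) → ∃ λ t → ¬ A t (α t)

  Alive-antitone : ∀ {A s t x} → s ≤ t → Alive A t x → Alive A s x
  Alive-antitone {A} {s} {zero}  z≤n a = a
  Alive-antitone {A} {s} {suc t} s≤1+t a@(_ , ((z , r , _) , _)) with m<1+n⇒m<n∨m≡n (s≤s s≤1+t)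
  ... | inj₂ refl = a
  ... | inj₁ (s≤s s≤t) = Alive-antitone {A} s≤t (z , r)

  Reach-start : ∀ {A} t {x v} → Reach A t x v → A 0 x
  Reach-start zero    (a , _) = a
  Reach-start (suc t) ((_ , r , _) , _) = Reach-start t r

  Reach-end : ∀ {A} t {x v} → Reach A t x v → A t v
  Reach-end zero    (a , refl) = a
  Reach-end (suc t) (_ , a) = a

  Reach-cons : ∀ {A} t {x y v} → A 0 x → x ⇝ y → Reach (shift A) t y v → Reach A (suc t) x v
  Reach-cons zero    a s (b , refl) = (_ , (a , refl) , s) , b
  Reach-cons (suc t) a s ((z , r , e) , b) = (z , Reach-cons t a s r , e) , b

  Reach-uncons : ∀ {A} t {x v} → Reach A (suc t) x v → ∃ λ y → x ⇝ y × Reach (shift A) t y v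
  Reach-uncons zero    ((z , (_ , refl) , s) , b) = _ , s , b , refl
  Reach-uncons (suc t) ((z , r , e) , b) with Reach-uncons t r
  ... | y , s , r′ = y , s , (z , r′ , e) , b

  Reach-trace : ∀ {A} (A? : ∀ t v → Dec (A t v)) (α : ℕ → Fin n) → (∀ t → α t ⇝ α (suc t)) →
                ∀ t → Reach A t (α 0) (α t) ⊎ ∃ λ s → ¬ A s (α s)
  Reach-trace A? α steps zero with A? 0 (α 0)
  ... | yes a = inj₁ (a , refl)
  ... | no ¬a = inj₂ (0 , ¬a)
  Reach-trace A? α steps (suc t) with Reach-trace A? α steps t | A? (suc t) (α (suc t))
  ... | inj₂ e | _     = inj₂ e
  ... | inj₁ r | yes a = inj₁ ((α t , r , steps t) , a)
  ... | inj₁ r | no ¬a = inj₂ (suc t , ¬a)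

  reach? : ∀ {A} → (∀ t v → Dec (A t v)) → ∀ t x v → Dec (Reach A t x v)
  reach? A? zero    x v = A? 0 x ×-dec (x ≟ v)
  reach? A? (suc t) x v = any? (λ z → reach? A? t x z ×-dec (z ⇝? v)) ×-dec A? (suc t) v

  alive? : ∀ {A} → (∀ t v → Dec (A t v)) → ∀ t x → Dec (Alive A t x)
  alive? A? t x = any? (reach? A? t x)

  Escapeless-step : ∀ {A x y} → A 0 x → x ⇝ y → Escapeless A x → Escapeless (shift A) y
  Escapeless-step {A} {x} {y} a x⇝y esc α refl steps
    with esc (λ { zero → x ; (suc t) → α t }) refl (λ { zero → x⇝y ; (suc t) → steps t })
  ... | zero  , ¬a = contradiction a ¬a
  ... | suc t , ¬a = t , ¬a

  Mortal-step : ∀ {A x} → (∀ y → x ⇝ y → Mortal (shift A) y) → Mortal A x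
  Mortal-step {A} {x} mortal =
    let t , dead = uniform-bound (λ y t → ¬ (x ⇝ y × Alive (shift A) t y))
                     (λ y s≤t ¬a (s , a) → ¬a (s , Alive-antitone {shift A} s≤t a)) bound
    in suc t , λ (v , r) → let y , s , r′ = Reach-uncons t r in dead y (s , v , r′)
    where
    bound : ∀ y → ∃ λ t → ¬ (x ⇝ y × Alive (shift A) t y)
    bound y with x ⇝? y
    ... | no ¬s = 0 , λ (s , _) → ¬s s
    ... | yes s = let t , ¬a = mortal y s in t , λ (_ , a) → ¬a a

  -- A constructive fan theorem.  The vertices reachable from y but not from z, taken as long as
  -- z is alive, form a thinner family; once that family is dead at time t, either z is dead or
  -- all that y reaches at time t is reached by z as well.
  module Compare {A : ℕ → Fin n → Set} (A? : ∀ t v → Dec (A t v)) (y z : Fin n) where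

    Only : ℕ → Fin n → Set
    Only t v = (Reach A t y v × ¬ Reach A t z v) × Alive A t z

    only? : ∀ t v → Dec (Only t v)
    only? t v = (reach? A? t y v ×-dec ¬? (reach? A? t z v)) ×-dec alive? A? t z

    only-thinner : ∀ {w} t → count (A? t) ≤ suc w → count (only? t) ≤ w
    only-thinner {w} t width = thinner (alive? A? t z)
      where
      thinner : Dec (Alive A t z) → count (only? t) ≤ w
      -- A vertex reached by `z` lies in `A t` but not in `Only t`, so the width drops.
      thinner (yes (v , r)) = ≤-pred (≤-trans
        (count-⊂ (only? t) (A? t) (λ _ ((r′ , _) , _) → Reach-end t r′) v (Reach-end t r)
          (λ ((_ , ¬r) , _) → ¬r r)) width)
      thinner (no ¬a) = ≤-trans (≤-reflexive (count-empty (only? t) (λ _ (_ , a) → ¬a a))) z≤n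

    -- If `z` reached an earlier vertex of the walk at the same time, the rest of the walk would
    -- take `z` to `v`. Hence the whole walk lies in `Only`.
    only-reach : ∀ t {v} → Alive A t z → Reach A t y v → ¬ Reach A t z v → Reach Only t y v
    only-reach zero al r@(a , refl) ¬r = ((r , ¬r) , al) , refl
    only-reach (suc t) al r@((x , q , s) , b) ¬r =
      (x , only-reach t (Alive-antitone {A} (m≤n⇒m≤1+n ≤-refl) al) q (λ q′ → ¬r ((x , q′ , s) , b)) , s) ,
      ((r , ¬r) , al)

    catch-up : ∀ {t} → (∀ v → Reach A t y v → Reach A t z v) →
               ∀ e v → Reach A (e + t) y v → Reach A (e + t) z v
    catch-up sub zero    v r = sub v r
    catch-up sub (suc e) v ((x , r , s) , a) = (x , catch-up sub e x r , s) , a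

    compare : Mortal Only y → (Mortal A y → Mortal A z) ⊎ (Mortal A z → Mortal A y)
    compare (t , dead) with alive? A? t z
    ... | no ¬a = inj₁ (λ _ → t , ¬a)
    ... | yes al = inj₂ (λ (e , ¬a) → e + t , λ (v , r) →
            ¬a (Alive-antitone {A} (m≤m+n e t) (v , catch-up sub e v r)))
      where
      sub : ∀ v → Reach A t y v → Reach A t z v
      sub v r = decidable-stable (reach? A? t z v) (λ ¬r → dead (v , only-reach t al r ¬r))

  module Longest {w : ℕ}
    (ih : ∀ {A} (A? : ∀ t v → Dec (A t v)) x → (∀ t → count (A? t) ≤ w) → Escapeless A x → Mortal A x)
    where

    -- Lifetimes are not compared as numbers: `y` is longest-lived if its mortality implies that of
    -- every other successor. Two candidates are compared through the induction hypothesis for the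
    -- thinner family `Only`, and a running best suffices because such implications compose.
    longest-lived : ∀ {A} (A? : ∀ t v → Dec (A t v)) → (∀ t → count (A? t) ≤ suc w) →
                    ∀ x → (∀ y → x ⇝ y → Escapeless A y) →
                    ∃ λ y → x ⇝ y × (Mortal A y → ∀ z → x ⇝ z → Mortal A z)
    longest-lived {A} A? width x esc =
      let y , s , best = among (allFin n)
      in y , s , λ m z → List.lookup best (∈-allFin z) m
      where
      among : ∀ l → ∃ λ y → x ⇝ y × List.All (λ z → Mortal A y → x ⇝ z → Mortal A z) l
      among [] = x , ⇝-refl , []
      among (z ∷ l) with among l | x ⇝? z
      ... | y , s , best | no ¬s = y , s , (λ _ s → contradiction s ¬s) ∷ best
      ... | y , s , best | yes s′
        with Compare.compare A? y z (ih (Compare.only? A? y z) y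
               (λ t → Compare.only-thinner A? y z t (width t))
               (λ α α₀ steps → let t , ¬a = esc y s α α₀ steps in t , λ ((r , _) , _) → ¬a (Reach-end t r)))
      ... | inj₁ y≥z = y , s , (λ m _ → y≥z m) ∷ best
      ... | inj₂ z≥y = z , s′ , (λ m _ → m) ∷ List.map (λ f m → f (z≥y m)) best

    next : ∀ {A} (A? : ∀ t v → Dec (A t v)) → (∀ t → count (A? t) ≤ suc w) → ∀ x → Escapeless A x → A 0 x →
           ∃ λ y → x ⇝ y × (Mortal (shift A) y → Mortal A x) × Escapeless (shift A) y
    next {A} A? width x esc a =
      let y , s , best = longest-lived (λ t → A? (suc t)) (λ t → width (suc t)) x
                           (λ y s → Escapeless-step {A} a s esc)
      in y , s , (λ m → Mortal-step (best m)) , Escapeless-step {A} a s esc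

    -- The greedy walk, always moving to a longest-lived successor. Once outside the allowed set it
    -- stands still, which makes it an infinite walk.
    path : ∀ {A} (A? : ∀ t v → Dec (A t v)) → (∀ t → count (A? t) ≤ suc w) → ∀ x → Escapeless A x → ℕ → Fin n
    path A? width x esc zero = x
    path A? width x esc (suc t) with A? 0 x
    ... | no _  = x
    ... | yes a = let y , _ , _ , esc′ = next A? width x esc a
                  in path (λ t → A? (suc t)) (λ t → width (suc t)) y esc′ t

    path-steps : ∀ {A} (A? : ∀ t v → Dec (A t v)) (width : ∀ t → count (A? t) ≤ suc w)
                 x (esc : Escapeless A x) →
                 ∀ t → path A? width x esc t ⇝ path A? width x esc (suc t)
    path-steps A? width x esc zero with A? 0 x
    ... | no _  = ⇝-refl
    ... | yes a = proj₁ (proj₂ (next A? width x esc a))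
    path-steps A? width x esc (suc t) with A? 0 x
    ... | no _  = ⇝-refl
    ... | yes a = let y , _ , _ , esc′ = next A? width x esc a
                  in path-steps (λ t → A? (suc t)) (λ t → width (suc t)) y esc′ t

    -- The vertex at which the greedy walk leaves `A` is mortal, and mortality travels back along
    -- the walk, since each step went to a longest-lived successor.
    path-longest : ∀ {A} (A? : ∀ t v → Dec (A t v)) (width : ∀ t → count (A? t) ≤ suc w)
                   x (esc : Escapeless A x) →
                   ∀ t → ¬ A t (path A? width x esc t) → Mortal A x
    path-longest A? width x esc zero ¬a = 0 , λ (_ , a , _) → ¬a a
    path-longest A? width x esc (suc t) ¬a with A? 0 x
    ... | no ¬a₀ = 0 , λ (_ , a , _) → ¬a₀ a
    ... | yes a = let y , _ , m , esc′ = next A? width x esc a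
                  in m (path-longest (λ t → A? (suc t)) (λ t → width (suc t)) y esc′ t ¬a)

  -- Induction on the width `w`: the greedy walk has to leave `A` by hypothesis, and its choices use
  -- the statement for smaller width.
  escapeless⇒mortal : ∀ w {A} (A? : ∀ t v → Dec (A t v)) x →
                      (∀ t → count (A? t) ≤ w) → Escapeless A x → Mortal A x
  escapeless⇒mortal zero    A? x width esc = 0 , λ (_ , a , _) → count≤0⇒empty (A? 0) (width 0) x a
  escapeless⇒mortal (suc w) A? x width esc =
    let t , ¬a = esc (path A? width x esc) refl (path-steps A? width x esc)
    in path-longest A? width x esc t ¬a
    where open Longest (escapeless⇒mortal w)

-- Distances, induced cycles and chordality

¬Any⇒All¬ : ∀ {A : Set} {m} {P : A → Set} (xs : Vec A m) → ¬ Any P xs → All (λ z → ¬ P z) xs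
¬Any⇒All¬ []       ¬p = []
¬Any⇒All¬ (x ∷ xs) ¬p = (λ p → ¬p (here p)) ∷ ¬Any⇒All¬ xs (λ p → ¬p (there p))

-- Cyclic successor modulo `N` without division, which suits case analysis on indices.
Next : ℕ → ℕ → ℕ → Set
Next N i j = suc i ≡ j ⊎ (suc i ≡ N × j ≡ 0)

Next⇒mod : ∀ {M i j} → j < suc M → Next (suc M) i j → j ≡ (i + 1) % suc M
Next⇒mod {M} {i} j<N (inj₁ refl) rewrite +-comm i 1 = sym (m<n⇒m%n≡m j<N)
Next⇒mod {M} {i} j<N (inj₂ (refl , refl)) rewrite +-comm i 1 = sym (n%n≡0 (suc i))

mod⇒Next : ∀ {M i j} → i < suc M → j ≡ (i + 1) % suc M → Next (suc M) i j
mod⇒Next {M} {i} {j} i<N e rewrite +-comm i 1 with suc i ≟ℕ suc M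
... | yes refl = inj₂ (refl , trans e (n%n≡0 (suc i)))
... | no i+1≢N = inj₁ (sym (trans e (m<n⇒m%n≡m (≤∧≢⇒< i<N i+1≢N))))

module _ (G : Graph) where
  open Graph G using (n; adj; irrefl) renaming (sym to adj-sym)

  anyFin⁺ : ∀ {m} (f : Fin m → Bool) i → f i ≡ true → anyFin G f ≡ true
  anyFin⁺ f zero    fi rewrite fi = refl
  anyFin⁺ f (suc i) fi with f zero
  ... | true  = refl
  ... | false = anyFin⁺ (λ i → f (suc i)) i fi

  anyFin⁻ : ∀ {m} (f : Fin m → Bool) → anyFin G f ≡ true → ∃ λ i → f i ≡ true
  anyFin⁻ {suc m} f eq with f zero in f₀
  ... | true  = zero , f₀
  ... | false = let i , fi = anyFin⁻ (λ i → f (suc i)) eq in suc i , fi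

  adj? : ∀ x y → Dec (adj x y ≡ true)
  adj? x y = adj x y ≟ᵇ true

  step? : Decidable (Step G)
  step? x y = (x ≟ y) ⊎-dec adj? x y

  adj-flip : ∀ {x y} → adj x y ≡ true → adj y x ≡ true
  adj-flip {x} {y} a = trans (adj-sym y x) a

  adj-irrefl : ∀ {x} → adj x x ≢ true
  adj-irrefl {x} a with trans (sym a) (irrefl x)
  ... | ()

  step-flip : ∀ {x y} → Step G x y → Step G y x
  step-flip (inj₁ e) = inj₁ (sym e)
  step-flip (inj₂ a) = inj₂ (adj-flip a)

  step-adj : ∀ {x y} → Step G x y → x ≢ y → adj x y ≡ true
  step-adj (inj₁ e) x≢y = contradiction e x≢y
  step-adj (inj₂ a) _   = a

  stepB⁺ : ∀ {x y} → Step G x y → stepB G x y ≡ true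
  stepB⁺ {x} {y} s with x ≟ y
  ... | yes _  = refl
  ... | no x≢y = step-adj s x≢y

  stepB⁻ : ∀ {x y} → stepB G x y ≡ true → Step G x y
  stepB⁻ {x} {y} e with x ≟ y
  ... | yes x≡y = inj₁ x≡y
  ... | no _    = inj₂ e

  Dist≤-zero⁻ : ∀ {x y} → Dist≤ G 0 x y → x ≡ y
  Dist≤-zero⁻ {x} {y} e with x ≟ y
  ... | yes x≡y = x≡y

  Dist≤-zero⁺ : ∀ x → Dist≤ G 0 x x
  Dist≤-zero⁺ x with x ≟ x
  ... | yes _ = refl
  ... | no x≢x = contradiction refl x≢x

  Dist≤-cons : ∀ k {x y z} → Step G x y → Dist≤ G k y z → Dist≤ G (suc k) x z
  Dist≤-cons k {x} {y} {z} s d = anyFin⁺ (λ w → stepB G x w ∧ within G k w z) y (cong₂ _∧_ (stepB⁺ s) d)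

  Dist≤-uncons : ∀ k {x z} → Dist≤ G (suc k) x z → ∃ λ y → Step G x y × Dist≤ G k y z
  Dist≤-uncons k {x} {z} e with anyFin⁻ (λ w → stepB G x w ∧ within G k w z) e
  ... | y , e′ with stepB G x y in s
  ... | true = y , stepB⁻ s , e′

  Dist≤-refl : ∀ k x → Dist≤ G k x x
  Dist≤-refl zero    x = Dist≤-zero⁺ x
  Dist≤-refl (suc k) x = Dist≤-cons k (inj₁ refl) (Dist≤-refl k x)

  Dist≤-mono : ∀ {j k x y} → j ≤ k → Dist≤ G j x y → Dist≤ G k x y
  Dist≤-mono {k = k} {x} z≤n d = subst (Dist≤ G k x) (Dist≤-zero⁻ d) (Dist≤-refl k x)
  Dist≤-mono {suc j} {suc k} (s≤s j≤k) d =
    let _ , s , d′ = Dist≤-uncons j d in Dist≤-cons k s (Dist≤-mono j≤k d′)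

  Dist≤-snoc : ∀ k {x y z} → Dist≤ G k x y → Step G y z → Dist≤ G (suc k) x z
  Dist≤-snoc zero {x} {y} {z} d s with Dist≤-zero⁻ d
  ... | refl = Dist≤-cons 0 s (Dist≤-zero⁺ z)
  Dist≤-snoc (suc k) d s = let _ , s′ , d′ = Dist≤-uncons k d in Dist≤-cons (suc k) s′ (Dist≤-snoc k d′ s)

  dist≤? : ∀ k x y → Dec (Dist≤ G k x y)
  dist≤? k x y = within G k x y ≟ᵇ true

  Step⇒Dist≤1 : ∀ {x y} → Step G x y → Dist≤ G 1 x y
  Step⇒Dist≤1 {y = y} s = Dist≤-cons 0 s (Dist≤-zero⁺ y)

  -- Strict decrease of the distance to `r`, expressed without a distance function: `d` is a radius
  -- separating the two distances.
  Closer : V G → V G → V G → Set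
  Closer u u′ r = Step G u u′ × ∃ λ d → Dist≤ G d u′ r × ¬ Dist≤ G d u r

  Closer-pred : ∀ {u u′ r} → Closer u u′ r → ∀ d → Dist≤ G (suc d) u r → Dist≤ G d u′ r
  Closer-pred (_ , e , near , ¬near) d far with e ≤? d
  ... | yes e≤d = Dist≤-mono e≤d near
  ... | no e≰d  = contradiction (Dist≤-mono (≰⇒> e≰d) far) ¬near

  Closer-adjacent : ∀ {u u′ r} → Step G u r → Closer u u′ r → u′ ≡ r
  Closer-adjacent s (_ , zero  , d , ¬d) = Dist≤-zero⁻ d
  Closer-adjacent {u} {_} {r} s (_ , suc e , d , ¬d) =
    contradiction (Dist≤-mono {1} {suc e} {u} {r} (s≤s z≤n) (Step⇒Dist≤1 s)) ¬d

  approach : ∀ k u r → Dist≤ G k u r → u ≡ r ⊎ ∃ λ u′ → Closer u u′ r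
  approach zero    u r d = inj₁ (Dist≤-zero⁻ d)
  approach (suc k) u r d with dist≤? k u r
  ... | yes d′ = approach k u r d′
  ... | no ¬d  = let u′ , s , d′ = Dist≤-uncons k d in inj₂ (u′ , s , k , d′ , ¬d)

  -- Since `Step` is reflexive, `¬ Step` rules out repeated vertices as well as chords.
  Induced : ∀ {m} → Vec (V G) m → Set
  Induced []           = ⊤
  Induced (x ∷ [])     = ⊤
  Induced (x ∷ y ∷ zs) = adj x y ≡ true × All (λ z → ¬ Step G x z) zs × Induced (y ∷ zs)

  Induced-next : ∀ {m} (xs : Vec (V G) m) → Induced xs → ∀ i j → suc (toℕ i) ≡ toℕ j →
                 adj (lookup xs i) (lookup xs j) ≡ true
  Induced-next (x ∷ y ∷ zs) (a , _ , _) zero    (suc zero) _ = a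
  Induced-next (x ∷ y ∷ zs) (_ , _ , p) (suc i) (suc j)    e = Induced-next (y ∷ zs) p i j (suc-injective e)

  Induced-adj⇒ : ∀ {m} (xs : Vec (V G) m) → Induced xs → ∀ i j → adj (lookup xs i) (lookup xs j) ≡ true →
                 suc (toℕ i) ≡ toℕ j ⊎ suc (toℕ j) ≡ toℕ i
  Induced-adj⇒ (x ∷ zs)     p zero zero a = contradiction a adj-irrefl
  Induced-adj⇒ (x ∷ y ∷ zs) p zero (suc zero) a = inj₁ refl
  Induced-adj⇒ (x ∷ y ∷ zs) (_ , far , _) zero (suc (suc j)) a = contradiction (inj₂ a) (lookup⁺ far j)
  Induced-adj⇒ (x ∷ y ∷ zs) p (suc zero) zero a = inj₂ refl
  Induced-adj⇒ (x ∷ y ∷ zs) (_ , far , _) (suc (suc i)) zero a =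
    contradiction (inj₂ (adj-flip a)) (lookup⁺ far i)
  Induced-adj⇒ (x ∷ y ∷ zs) (_ , _ , p) (suc i) (suc j) a =
    ⊎-map (cong suc) (cong suc) (Induced-adj⇒ (y ∷ zs) p i j a)

  Induced-head≢ : ∀ {m} x (ys : Vec (V G) m) → Induced (x ∷ ys) → ∀ j → x ≢ lookup ys j
  Induced-head≢ x (y ∷ zs) (a , _ , _)   zero    refl = adj-irrefl a
  Induced-head≢ x (y ∷ zs) (_ , far , _) (suc j) e    = lookup⁺ far j (inj₁ e)

  Induced-injective : ∀ {m} (xs : Vec (V G) m) → Induced xs → ∀ i j → lookup xs i ≡ lookup xs j → i ≡ j
  Induced-injective (x ∷ zs)     p zero    zero    e = refl
  Induced-injective (x ∷ zs)     p zero    (suc j) e = contradiction e (Induced-head≢ x zs p j)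
  Induced-injective (x ∷ zs)     p (suc i) zero    e = contradiction (sym e) (Induced-head≢ x zs p i)
  Induced-injective (x ∷ y ∷ zs) (_ , _ , p) (suc i) (suc j) e = cong suc (Induced-injective (y ∷ zs) p i j e)

  Avoiding : V G → V G → V G → Set
  Avoiding u x y = Step G x y × ¬ Step G u x × ¬ Step G u y

  module _ (u b : V G) where

    -- The shape of a path that runs inside G - N[u] and leaves it only by its final step to a
    -- border vertex `b`.
    LeavesTo : ∀ {m} → Vec (V G) (suc m) → Set
    LeavesTo (x ∷ [])     = x ≡ b
    LeavesTo (x ∷ y ∷ zs) = ¬ Step G u x × LeavesTo (y ∷ zs)

    LeavesTo-last : ∀ {m} (xs : Vec (V G) (suc m)) → LeavesTo xs → ∀ i → toℕ i ≡ m → lookup xs i ≡ b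
    LeavesTo-last (x ∷ [])     e zero _ = e
    LeavesTo-last (x ∷ y ∷ zs) (_ , l) (suc i) e = LeavesTo-last (y ∷ zs) l i (suc-injective e)

    LeavesTo-inner : ∀ {m} (xs : Vec (V G) (suc m)) → LeavesTo xs → ∀ i → toℕ i ≢ m → ¬ Step G u (lookup xs i)
    LeavesTo-inner (x ∷ [])     e zero i≢m = contradiction refl i≢m
    LeavesTo-inner (x ∷ y ∷ zs) (¬s , _) zero i≢m = ¬s
    LeavesTo-inner (x ∷ y ∷ zs) (_ , l) (suc i) i≢m = LeavesTo-inner (y ∷ zs) l i (λ e → i≢m (cong suc e))

    -- A suffix of a path, cut at the last vertex in N[x]. Prepending `x` keeps it induced, unless
    -- `x` is `first` itself.
    record Attached (x : V G) : Set where
      constructor attached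
      field
        {size}  : ℕ
        first   : V G
        rest    : Vec (V G) size
        induced : Induced (first ∷ rest)
        leaves  : LeavesTo (first ∷ rest)
        near    : Step G x first
        far     : All (λ z → ¬ Step G x z) rest

    attach : ∀ x {m} (xs : Vec (V G) (suc m)) → Induced xs → LeavesTo xs → Any (Step G x) xs → Attached x
    attach x (y ∷ []) p l (here s) = attached y [] p l s []
    attach x (y ∷ z ∷ zs) p l a with anyᵛ? (step? x) (z ∷ zs)
    ... | yes a′ = attach x (z ∷ zs) (proj₂ (proj₂ p)) (proj₂ l) a′
    attach x (y ∷ z ∷ zs) p l (here s)  | no ¬a = attached y (z ∷ zs) p l s (¬Any⇒All¬ _ ¬a)
    attach x (y ∷ z ∷ zs) p l (there a) | no ¬a = contradiction a ¬a

    -- The walk is shortcut starting from its far end: each further vertex is attached to the last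
    -- path vertex near it, which removes all chords.
    induced-path : ∀ {p x} → Star (Avoiding u) p x → ¬ Step G u p → adj x b ≡ true →
                   ∃ λ m → Σ (Vec (V G) m) λ zs → Induced (p ∷ zs) × LeavesTo (p ∷ zs)
    induced-path ε ¬s a = 1 , b ∷ [] , (a , [] , tt) , (¬s , refl)
    induced-path {p} ((s , _ , ¬sq) ◅ w) ¬sp a with induced-path w ¬sq a
    ... | _ , zs , i , l with attach p (_ ∷ zs) i l (here s)
    ... | attached y ys i′ l′ near far with p ≟ y
    ... | yes refl = _ , ys , i′ , l′
    ... | no p≢y   = _ , y ∷ ys , (step-adj near p≢y , far , i′) , (¬sp , l′)

  avoiding? : ∀ u → Decidable (Avoiding u)
  avoiding? u x y = step? x y ×-dec (¬? (step? u x) ×-dec ¬? (step? u y))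

  -- For `r` outside N[u], the size of the component of G - N[u] containing `r`. This is the measure
  -- by which the pursuit terminates.
  territory : V G → V G → ℕ
  territory u r = count (star? (avoiding? u) r)

  avoids-end : ∀ {u x y} → ¬ Step G u x → Star (Avoiding u) x y → ¬ Step G u y
  avoids-end ¬x ε = ¬x
  avoids-end ¬x ((_ , _ , ¬y) ◅ w) = avoids-end ¬y w

  module _ {u a b : V G} (u~a : adj u a ≡ true) (u~b : adj u b ≡ true) {j : ℕ} (xs : Vec (V G) (2 + j))
           (ind : Induced (a ∷ xs)) (leaves : LeavesTo u b xs) where

    private
      ws : Vec (V G) (3 + j)
      ws = a ∷ xs

      c : Fin (4 + j) → V G
      c = lookup (u ∷ ws)

      hub-last : ∀ i → toℕ i ≡ 2 + j → adj u (lookup ws i) ≡ true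
      hub-last (suc i) e =
        subst (λ z → adj u z ≡ true) (sym (LeavesTo-last u b xs leaves i (suc-injective e))) u~b

      hub-inner : ∀ i → adj u (lookup ws i) ≡ true → toℕ i ≡ 0 ⊎ toℕ i ≡ 2 + j
      hub-inner zero    _ = inj₁ refl
      hub-inner (suc i) e with toℕ i ≟ℕ 1 + j
      ... | yes i≡ = inj₂ (cong suc i≡)
      ... | no i≢  = contradiction (inj₂ e) (LeavesTo-inner u b xs leaves i i≢)

      hub≢ : ∀ i → u ≢ lookup ws i
      hub≢ zero    refl = adj-irrefl u~a
      hub≢ (suc i) e with toℕ i ≟ℕ 1 + j
      ... | yes i≡ = adj-irrefl (trans (cong (adj u) (trans e (LeavesTo-last u b xs leaves i i≡))) u~b)
      ... | no i≢  = LeavesTo-inner u b xs leaves i i≢ (inj₁ e)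

      c-injective : ∀ {x y} → c x ≡ c y → x ≡ y
      c-injective {zero}  {zero}  e = refl
      c-injective {zero}  {suc y} e = contradiction e (hub≢ y)
      c-injective {suc x} {zero}  e = contradiction (sym e) (hub≢ x)
      c-injective {suc x} {suc y} e = cong suc (Induced-injective ws ind x y e)

      N : ℕ
      N = 4 + j

      hub-next : ∀ y → adj u (lookup ws y) ≡ true → Next N 0 (suc (toℕ y)) ⊎ Next N (suc (toℕ y)) 0
      hub-next y e with hub-inner y e
      ... | inj₁ y≡0 = inj₁ (inj₁ (cong suc (sym y≡0)))
      ... | inj₂ y≡  = inj₂ (inj₂ (cong (λ k → suc (suc k)) y≡ , refl))

      c-adj⇒ : ∀ x y → adj (c x) (c y) ≡ true → Next N (toℕ x) (toℕ y) ⊎ Next N (toℕ y) (toℕ x)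
      c-adj⇒ zero    zero    e = contradiction e adj-irrefl
      c-adj⇒ zero    (suc y) e = hub-next y e
      c-adj⇒ (suc x) zero    e = swap (hub-next x (adj-flip e))
      c-adj⇒ (suc x) (suc y) e =
        ⊎-map (λ p → inj₁ (cong suc p)) (λ p → inj₁ (cong suc p)) (Induced-adj⇒ ws ind x y e)

      c-next : ∀ x y → Next N (toℕ x) (toℕ y) → adj (c x) (c y) ≡ true
      c-next zero    (suc zero) (inj₁ e) = u~a
      c-next (suc x) (suc y)    (inj₁ e) = Induced-next ws ind x y (suc-injective e)
      c-next (suc x) zero       (inj₂ (e , _)) = adj-flip (hub-last x (suc-injective (suc-injective e)))

    -- The hub `u` has index 0 and meets the induced path only at its ends `a` and `b`. The path has
    -- at least three vertices, so the cycle has at least four.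
    hub-cycle : IsInducedCycle G j c
    hub-cycle = c-injective , λ x y → mk⇔
      (λ e → ⊎-map (Next⇒mod (toℕ<n y)) (Next⇒mod (toℕ<n x)) (c-adj⇒ x y e))
      (λ { (inj₁ e) → c-next x y (mod⇒Next (toℕ<n x) e)
         ; (inj₂ e) → adj-flip (c-next y x (mod⇒Next (toℕ<n y) e)) })

  -- Chordal graphs: the robber's territory shrinks.

  module _ (chordal : Chordal G) where

    -- In a chordal graph the neighbours of u that border one component of G − N[u] form a clique.
    border-clique : ∀ {u a b p x} → adj u a ≡ true → adj u b ≡ true → Step G a p → ¬ Step G u p →
                    Star (Avoiding u) p x → adj x b ≡ true → Step G a b
    border-clique {u} {a} {b} {p} u~a u~b s ¬sp w x~b = decidable-stable (step? a b) λ ¬ab → go ¬ab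
      where
      go : ¬ Step G a b → ⊥
      go ¬ab with induced-path u b w ¬sp x~b
      -- The path from `p` to `b` is cut at its last vertex near `a`. If that vertex is not `b`,
      -- then `u`, `a` and the suffix form a forbidden cycle.
      ... | _ , zs , i , l with attach u b a (p ∷ zs) i l (here s)
      ... | attached y [] i′ refl near far = ¬ab near
      ... | attached y (z ∷ zs′) i′ l′ near far =
        chordal _ _ (hub-cycle u~a u~b (y ∷ z ∷ zs′) (step-adj near a≢y , far , i′) l′)
        where
        a≢y : a ≢ y
        a≢y refl = proj₁ l′ (inj₂ u~a)

    module _ {u u′ r : V G} (¬ur : ¬ Step G u r) (closer : Closer u u′ r) where

      private
        -- A vertex of N[u] on so short a walk to `r` would bring `u` within the excluded distance
        -- of `r`.
        geodesic : ∀ e {p} → Dist≤ G e p r → ¬ Dist≤ G (suc e) u r → Star (Avoiding u) p r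
        geodesic zero d ¬d with Dist≤-zero⁻ d
        ... | refl = ε
        geodesic (suc e) d ¬d with Dist≤-uncons e d
        ... | q , s , d′ = (s , (λ up → ¬d (Dist≤-cons (suc e) up d))
                              , (λ uq → ¬d′ (Dist≤-cons e uq d′))) ◅ geodesic e d′ ¬d′
          where
          ¬d′ : ¬ Dist≤ G (suc e) u r
          ¬d′ near = ¬d (Dist≤-mono {suc e} {x = u} {y = r} (m≤n⇒m≤1+n ≤-refl) near)

        avoiding-flip : ∀ {x y} → Avoiding u x y → Avoiding u y x
        avoiding-flip (s , ¬x , ¬y) = step-flip s , ¬y , ¬x

        gate : Closer u u′ r → ∃ λ p → Step G u′ p × ¬ Step G u p × Star (Avoiding u) p r
        gate (s , zero , d , _) = contradiction (subst (Step G u) (Dist≤-zero⁻ d) s) ¬ur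
        gate (s , suc e , d , ¬d) with Dist≤-uncons e d
        ... | p , s′ , d′ = p , s′ , (λ up → ¬d (Dist≤-cons e up d′)) , geodesic e d′ ¬d

        u~u′ : adj u u′ ≡ true
        u~u′ = let s , d , near , ¬near = closer in step-adj s (λ { refl → ¬near near })

        -- The component K of `r` can be left only through a neighbour `y` of `u` bordering K. As
        -- `u′` borders K too, `border-clique` puts `y` into N[u′], which is excluded.
        confined : ∀ {x y} → Star (Avoiding u) r x → Step G x y → ¬ Step G u′ y → Star (Avoiding u) r y
        confined {x} {y} w s ¬u′y with step? u y
        ... | no ¬uy = w ◅◅ ((s , ¬ux , ¬uy) ◅ ε)
          where
          ¬ux : ¬ Step G u x
          ¬ux = avoids-end ¬ur w
        ... | yes uy =
          let p , s′ , ¬up , w′ = gate closer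
          in contradiction
               (border-clique u~u′ (step-adj uy (λ { refl → ¬u′y (step-flip (inj₂ u~u′)) })) s′ ¬up (w′ ◅◅ w)
                 (step-adj s (λ { refl → avoids-end ¬ur w uy })))
               ¬u′y

        confined* : ∀ {x v} → Star (Avoiding u) r x → Star (Avoiding u′) x v → Star (Avoiding u) r v
        confined* w ε = w
        confined* w ((s , _ , ¬u′y) ◅ w′) = confined* (confined w s ¬u′y) w′

      -- By `confined` the new component is contained in the old one. The gate `p` belongs to the
      -- old one only, because it lies in N[u′].
      territory-shrinks : ∀ {r′} → Step G r r′ → ¬ Step G u′ r′ → territory u′ r′ < territory u r
      territory-shrinks {r′} s ¬u′r′ =
        let p , s′ , _ , w = gate closer
        in count-⊂ (star? (avoiding? u′) r′) (star? (avoiding? u) r) (λ _ → confined* (confined ε s ¬u′r′))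
             p (reverse avoiding-flip w) (λ w′ → avoids-end ¬u′r′ w′ s′)

-- Pursuit of a robber that has been seen

module _ (G : Graph) where

  observe-just : ∀ ℓ {k} (C : Conf G k) r i → Dist≤ G ℓ (C i) r → observe G ℓ C r ≡ just r
  observe-just ℓ C r i d rewrite anyFin⁺ G (λ i → within G ℓ (C i) r) i d = refl

  Unseen : ℕ → ∀ {k} → Conf G k → V G → Set
  Unseen ℓ C r = ∀ i → ¬ Dist≤ G ℓ (C i) r

  seen? : ∀ ℓ {k} (C : Conf G k) r → (∃ λ i → Dist≤ G ℓ (C i) r) ⊎ Unseen ℓ C r
  seen? ℓ C r with any? (λ i → dist≤? G ℓ (C i) r)
  ... | yes seen = inj₁ seen
  ... | no ¬seen = inj₂ λ i d → ¬seen (i , d)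

  observe-nothing : ∀ ℓ {k} (C : Conf G k) r → Unseen ℓ C r → observe G ℓ C r ≡ nothing
  observe-nothing ℓ C r unseen with anyFin G (λ i → within G ℓ (C i) r) in eq
  ... | true  = let i , d = anyFin⁻ G (λ i → within G ℓ (C i) r) eq in contradiction d (unseen i)
  ... | false = refl

  unseen? : ∀ ℓ {k} (C : Conf G k) r → Dec (Unseen ℓ C r)
  unseen? ℓ C r = all? (λ i → ¬? (dist≤? G ℓ (C i) r))

  module _ (ℓ : ℕ) {k : ℕ} (σ : CopStrategy G k) (ρ : RobberStrategy G k) where
    open Play G ℓ σ ρ

    run-round : ∀ s t → run (round s) t ≡ run s (suc t)
    run-round s zero    = refl
    run-round s (suc t) = cong round (run-round s t)

    later : ∀ (P : V G → V G → Set) s → Eventually P (round s) → Eventually P s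
    later P s (t , i , e) = suc t , i , subst
      (λ s′ → P (State.cops s′ i) (State.rob s′) ⊎ P (State.cops (round s′) i) (State.rob s′))
      (run-round s t) e

    later* : ∀ (P : V G → V G → Set) s t → Eventually P (run s t) → Eventually P s
    later* P s zero    e = e
    later* P s (suc t) e = later* P s t (later P (run s t) e)

  module _ (connected : Connected G) where

    toward : V G → V G → V G
    toward u r with approach G (proj₁ (connected u r)) u r (proj₂ (connected u r))
    ... | inj₁ _        = u
    ... | inj₂ (u′ , _) = u′

    toward-step : ∀ u r → Step G u (toward u r)
    toward-step u r with approach G (proj₁ (connected u r)) u r (proj₂ (connected u r))
    ... | inj₁ _           = inj₁ refl
    ... | inj₂ (_ , s , _) = s

    toward-closer : ∀ u r → u ≢ r → Closer G u (toward u r) r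
    toward-closer u r u≢r with approach G (proj₁ (connected u r)) u r (proj₂ (connected u r))
    ... | inj₁ u≡r     = contradiction u≡r u≢r
    ... | inj₂ (_ , c) = c

    toward-dist : ∀ u r d → Dist≤ G (suc d) u r → Dist≤ G d (toward u r) r
    toward-dist u r d far with approach G (proj₁ (connected u r)) u r (proj₂ (connected u r))
    ... | inj₁ refl    = Dist≤-refl G d u
    ... | inj₂ (_ , c) = Closer-pred G c d far

    -- The observations do not tell which cop sees the robber, so all cops give chase.
    pursue-move : ∀ {k} → CopStrategy G k → List (Maybe (V G)) → Conf G k → Conf G k
    pursue-move σ []                      C = CopStrategy.move σ [] C
    pursue-move σ (just r ∷ h)            C = λ i → toward (C i) r
    pursue-move σ (nothing ∷ [])          C = CopStrategy.move σ (nothing ∷ []) C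
    pursue-move σ (nothing ∷ just r ∷ h)  C = λ i → toward (C i) r
    pursue-move σ (nothing ∷ nothing ∷ h) C = CopStrategy.move σ (nothing ∷ nothing ∷ h) C

    pursue : ∀ {k} → CopStrategy G k → CopStrategy G k
    pursue σ = record
      { start = CopStrategy.start σ
      ; move  = pursue-move σ
      ; legal = legal
      }
      where
      legal : ∀ h C i → Step G (C i) (pursue-move σ h C i)
      legal []                      C i = CopStrategy.legal σ [] C i
      legal (just r ∷ h)            C i = toward-step (C i) r
      legal (nothing ∷ [])          C i = CopStrategy.legal σ (nothing ∷ []) C i
      legal (nothing ∷ just r ∷ h)  C i = toward-step (C i) r
      legal (nothing ∷ nothing ∷ h) C i = CopStrategy.legal σ (nothing ∷ nothing ∷ h) C i

    pursue-silent : ∀ {k} (σ : CopStrategy G k) h C → List.All (_≡ nothing) h →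
                    pursue-move σ h C ≡ CopStrategy.move σ h C
    pursue-silent σ []                      C _ = refl
    pursue-silent σ (nothing ∷ [])          C _ = refl
    pursue-silent σ (nothing ∷ nothing ∷ h) C _ = refl
    pursue-silent σ (just _ ∷ _)            C (() ∷ _)
    pursue-silent σ (nothing ∷ just _ ∷ _)  C (_ ∷ () ∷ _)

    -- The newest observation follows the robber's move, the one before it follows the cops' move.
    -- In the `lagging` case the robber was seen at `s` after the cops' move and then went to `r`,
    -- perhaps out of sight.
    data Tracked (ℓ : ℕ) {k} (i : Fin k) : State G k → Set where
      visible : ∀ {C r h H} → Dist≤ G ℓ (C i) r → Tracked ℓ i (st C r (observe G ℓ C r ∷ h) H)
      lagging : ∀ {C r s h H} → Dist≤ G ℓ (C i) s → Step G s r →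
                Tracked ℓ i (st C r (observe G ℓ C r ∷ just s ∷ h) H)

    module _ {ℓ : ℕ} {k : ℕ} (σ : CopStrategy G k) (i : Fin k) where

      pursue-visible : ∀ (C : Conf G k) r h → observe G (suc ℓ) C r ≡ just r → Dist≤ G (suc (suc ℓ)) (C i) r →
        C i ≢ r → let u′ = pursue-move σ (observe G (suc ℓ) C r ∷ h) C i
                  in Closer G (C i) u′ r × Dist≤ G (suc ℓ) u′ r
      pursue-visible C r h obs d u≢r rewrite obs = toward-closer (C i) r u≢r , toward-dist (C i) r (suc ℓ) d

      pursue-closer : ∀ s → Tracked (suc ℓ) i s → let open State s in cops i ≢ rob →
        let u′ = pursue-move σ copH cops i in Closer G (cops i) u′ rob × Dist≤ G (suc ℓ) u′ rob
      pursue-closer _ (visible {C} {r} {h} d) u≢r =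
        pursue-visible C r h (observe-just (suc ℓ) C r i d)
          (Dist≤-mono G {suc ℓ} {x = C i} {r} (m≤n⇒m≤1+n ≤-refl) d) u≢r
      pursue-closer _ (lagging {C} {r} {s} {h} d s→r) u≢r with seen? (suc ℓ) C r
      ... | inj₁ (j , d′) = pursue-visible C r (just s ∷ h) (observe-just (suc ℓ) C r j d′)
                              (Dist≤-snoc G (suc ℓ) {C i} d s→r) u≢r
      ... | inj₂ unseen rewrite observe-nothing (suc ℓ) C r unseen =
        -- Moving toward the outdated position `s` still gets closer to `r`: the new vertex is
        -- within `suc ℓ` of `r`, and the old one was not, since nobody saw `r`.
        (toward-step (C i) s , suc ℓ , near , unseen i) , near
        where
        near : Dist≤ G (suc ℓ) (toward (C i) s) r
        near = Dist≤-snoc G ℓ (toward-dist (C i) s ℓ d) s→r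

    module _ (chordal : Chordal G) {ℓ k : ℕ} (σ : CopStrategy G k) (ρ : RobberStrategy G k) (i : Fin k) where
      open Play G (suc ℓ) (pursue σ) ρ
      open State

      capture-adjacent : ∀ s → Tracked (suc ℓ) i s → Step G (cops s i) (rob s) → Eventually _≡_ s
      capture-adjacent s tr a with cops s i ≟ rob s
      ... | yes u≡r = 0 , i , inj₁ u≡r
      ... | no u≢r  = 0 , i , inj₂ (Closer-adjacent G a (proj₁ (pursue-closer σ i s tr u≢r)))

      -- The robber is in view after the cops' move, so the older of the two new observations is
      -- `just (rob s)`, and its reply leaves the cop lagging by one step.
      tracked-round : ∀ s → Dist≤ G (suc ℓ) (pursue-move σ (copH s) (cops s) i) (rob s) →
                      Tracked (suc ℓ) i (round s)
      tracked-round s d = subst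
        (λ o → Tracked (suc ℓ) i (st C′ r′ (observe G (suc ℓ) C′ r′ ∷ o ∷ copH s) (C′ ∷ robH s)))
        (sym (observe-just (suc ℓ) C′ (rob s) i d))
        (lagging d (RobberStrategy.legal ρ _ _))
        where
        C′ = pursue-move σ (copH s) (cops s)
        r′ = RobberStrategy.move ρ (C′ ∷ robH s) (rob s)

      -- Each round either brings the robber into the cop's closed neighbourhood, where the next cop
      -- move captures, or strictly reduces the territory, which `m` bounds.
      capture-within : ∀ m s → Tracked (suc ℓ) i s → territory G (cops s i) (rob s) < m → Eventually _≡_ s
      capture-within (suc m) s tr (s≤s size) with step? G (cops s i) (rob s)
      ... | yes a = capture-adjacent s tr a
      ... | no ¬a with pursue-closer σ i s tr (λ e → ¬a (inj₁ e))
      ... | closer , near with step? G (cops (round s) i) (rob (round s))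
      ... | yes a = later (suc ℓ) (pursue σ) ρ _≡_ s (capture-adjacent (round s) (tracked-round s near) a)
      ... | no ¬a′ = later (suc ℓ) (pursue σ) ρ _≡_ s (capture-within m (round s) (tracked-round s near)
              (≤-trans (territory-shrinks G chordal ¬a closer (RobberStrategy.legal ρ _ _) ¬a′) size))

      capture : ∀ s → Tracked (suc ℓ) i s → Eventually _≡_ s
      capture s tr = capture-within _ s tr ≤-refl

    module _ (chordal : Chordal G) where

      stay : V G → CopStrategy G 1
      stay u = record { start = λ _ → u ; move = λ _ C → C ; legal = λ _ _ _ → inj₁ refl }

      captures-cops-turn : ∀ ℓ u r → Dist≤ G ℓ u r → OneCopCapturesCopsTurn G ℓ u r
      captures-cops-turn zero    u r d = stay u , λ ρ → 0 , zero , inj₁ (Dist≤-zero⁻ G d)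
      captures-cops-turn (suc ℓ) u r d = pursue (stay u) , λ ρ → capture chordal (stay u) ρ zero _ (visible d)

      captures-robbers-turn : ∀ ℓ u r → Dist≤ G ℓ u r → OneCopCapturesRobbersTurn G ℓ u r
      captures-robbers-turn zero    u r d = stay u , λ ρ → inj₁ (Dist≤-zero⁻ G d)
      captures-robbers-turn (suc ℓ) u r d = pursue (stay u) , λ ρ → inj₂ (capture chordal (stay u) ρ zero _
        (subst (λ o → Tracked (suc ℓ) zero (st (λ _ → u) _ (observe G (suc ℓ) {1} (λ _ → u) _ ∷ o ∷ []) _))
          (sym (observe-just (suc ℓ) {1} (λ _ → u) r zero d))
          (lagging d (RobberStrategy.legal ρ ((λ _ → u) ∷ []) r))))

      -- From a strategy that sees to one that captures.

      module _ {ℓ k : ℕ} (σ : CopStrategy G k) (ρ : RobberStrategy G k) where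
        private
          module P = Play G (suc ℓ) σ ρ
          module Q = Play G (suc ℓ) (pursue σ) ρ
          open State

          Silent : State G k → Set
          Silent s = Unseen (suc ℓ) (cops s) (rob s) × List.All (_≡ nothing) (copH s)

          -- Until the first sighting `pursue σ` makes the moves of `σ`, so the two plays pass
          -- through the same states.
          move-silent : ∀ s → Silent s → Q.round s ≡ P.round s
          move-silent s (_ , silent) = cong f (pursue-silent σ (copH s) (cops s) silent)
            where
            f : Conf G k → State G k
            f C′ = let r′ = RobberStrategy.move ρ (C′ ∷ robH s) (rob s)
                   in st C′ r′ (observe G (suc ℓ) C′ r′ ∷ observe G (suc ℓ) C′ (rob s) ∷ copH s) (C′ ∷ robH s)

          -- A first sighting after the cops' move starts the pursuit in the `lagging` form, one
          -- after the robber's move in the `visible` form.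
          silent-round : ∀ s → Silent s → Q.Eventually _≡_ (Q.round s) ⊎
                         (Silent (P.round s) × Unseen (suc ℓ) (cops (P.round s)) (rob s))
          silent-round s sil@(_ , silent) with seen? (suc ℓ) (cops (P.round s)) (rob s)
          ... | inj₁ (i , d) = inj₁ (capture chordal σ ρ i (Q.round s) (tracked-round chordal σ ρ i s
                  (subst (λ s′ → Dist≤ G (suc ℓ) (cops s′ i) (rob s)) (sym (move-silent s sil)) d)))
          ... | inj₂ un with seen? (suc ℓ) (cops (P.round s)) (rob (P.round s))
          ... | inj₁ (i , d) = inj₁ (capture chordal σ ρ i (Q.round s)
                  (subst (Tracked (suc ℓ) i) (sym (move-silent s sil)) (visible d)))
          ... | inj₂ un′ =
            inj₂ ((un′ , observe-nothing (suc ℓ) _ _ un′ ∷ observe-nothing (suc ℓ) _ _ un ∷ silent) , un)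

          delayed : ∀ t → Q.run Q.init t ≡ P.run P.init t → Q.Eventually _≡_ (Q.round (P.run P.init t)) →
                    Q.Eventually _≡_ Q.init
          delayed t eq e = later* (suc ℓ) (pursue σ) ρ _≡_ Q.init (suc t)
            (subst (λ s → Q.Eventually _≡_ (Q.round s)) (sym eq) e)

          silent-run : ∀ t → Q.Eventually _≡_ Q.init ⊎
                       (Q.run Q.init t ≡ P.run P.init t × Silent (P.run P.init t))
          silent-run zero with seen? (suc ℓ) (cops P.init) (rob P.init)
          ... | inj₁ (i , d) = inj₁ (capture chordal σ ρ i Q.init (visible d))
          ... | inj₂ un = inj₂ (refl , un , observe-nothing (suc ℓ) _ _ un ∷ [])
          silent-run (suc t) with silent-run t
          ... | inj₁ e = inj₁ e
          ... | inj₂ (eq , sil) with silent-round (P.run P.init t) sil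
          ... | inj₁ e = inj₁ (delayed t eq e)
          ... | inj₂ (sil′ , _) = inj₂ (trans (cong Q.round eq) (move-silent _ sil) , sil′)

        pursue-captures : P.Eventually (Dist≤ G (suc ℓ)) P.init → Q.Eventually _≡_ Q.init
        pursue-captures (t , i , e) with silent-run t
        ... | inj₁ win = win
        ... | inj₂ (eq , sil) with e | silent-round (P.run P.init t) sil
        ... | inj₁ d | _ = contradiction d (proj₁ sil i)
        ... | inj₂ d | inj₁ win = delayed t eq win
        ... | inj₂ d | inj₂ (_ , un) = contradiction d (un i)

      see⇒capture : ∀ ℓ k → CanSee G ℓ k → CanCapture G ℓ k
      -- At radius 0 seeing is capturing.
      see⇒capture zero k (σ , see) = σ , λ ρ →
        let t , i , e = see ρ in t , i , ⊎-map (Dist≤-zero⁻ G) (Dist≤-zero⁻ G) e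
      see⇒capture (suc ℓ) k (σ , see) = pursue σ , λ ρ → pursue-captures σ ρ (see ρ)

  capture⇒see : ∀ ℓ k → CanCapture G ℓ k → CanSee G ℓ k
  capture⇒see ℓ k (σ , win) = σ , λ ρ → let t , i , e = win ρ in t , i , ⊎-map near near e
    where
    near : ∀ {x y} → x ≡ y → Dist≤ G ℓ x y
    near {x} refl = Dist≤-refl G ℓ x

-- Searching for an unseen robber

bit : {P : Set} → Dec P → Fin 2
bit (yes _) = suc zero
bit (no _)  = zero

bit⁺ : {P : Set} (P? : Dec P) → P → bit P? ≡ suc zero
bit⁺ (yes _) p = refl
bit⁺ (no ¬p) p = contradiction p ¬p

bit⁻ : {P : Set} (P? : Dec P) → bit P? ≡ suc zero → P
bit⁻ (yes p) _ = p

module _ (G : Graph) where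
  open Graph G using (n)
  open Walks (Step G) (step? G) (inj₁ refl)

  -- A strategy must be legal from every position, also from those its own play never reaches. Off
  -- the schedule `f` it stands still.
  follow : (ℕ → V G) → ℕ → V G → V G
  follow f t x with x ≟ f t
  ... | yes _ = f (suc t)
  ... | no _  = x

  follow-legal : ∀ (f : ℕ → V G) → (∀ t → Step G (f t) (f (suc t))) → ∀ t x → Step G x (follow f t x)
  follow-legal f steps t x with x ≟ f t
  ... | yes refl = steps t
  ... | no _     = inj₁ refl

  follow-on : ∀ (f : ℕ → V G) t {x} → x ≡ f t → follow f t x ≡ f (suc t)
  follow-on f t {x} e with x ≟ f t
  ... | yes _ = refl
  ... | no ¬e = contradiction e ¬e

  module _ (ℓ : ℕ) {k : ℕ} where

    -- A robber ending round `t` at `x` is still there after the next cop move, so two successive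
    -- configurations must miss it.
    Hidden : (ℕ → Conf G k) → ℕ → V G → Set
    Hidden C t x = Unseen G ℓ (C t) x × Unseen G ℓ (C (suc t)) x

    hidden? : ∀ C t x → Dec (Hidden C t x)
    hidden? C t x = unseen? G ℓ (C t) x ×-dec unseen? G ℓ (C (suc t)) x

    Clears : (ℕ → Conf G k) → Set
    Clears C = (∀ t i → Step G (C t i) (C (suc t) i)) × ∃ λ T → ∀ x → ¬ Alive (Hidden C) T x

    module _ {C : ℕ → Conf G k} (clears : Clears C) where
      private
        legal = proj₁ clears
        T     = proj₁ (proj₂ clears)
        dead  = proj₂ (proj₂ clears)

      -- The history has length 2t + 1 when the cops make their move number t + 1.
      scheduled : CopStrategy G k
      scheduled = record
        { start = C 0
        ; move  = λ h D i → follow (λ t → C t i) ⌊ length h /2⌋ (D i)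
        ; legal = λ h D i → follow-legal (λ t → C t i) (λ t → legal t i) ⌊ length h /2⌋ (D i)
        }

      module _ (ρ : RobberStrategy G k) where
        open Play G ℓ scheduled ρ
        open State

        on-time : ∀ t → ⌊ length (copH (run init t)) /2⌋ ≡ t
        on-time zero    = refl
        on-time (suc t) = cong suc (on-time t)

        on-schedule : ∀ t i → cops (run init t) i ≡ C t i
        on-schedule zero    i = refl
        on-schedule (suc t) i rewrite on-time t = follow-on (λ t → C t i) t (on-schedule t i)

        found : ∀ {s} (α : ℕ → V G) → ¬ Hidden C s (α s) →
                ∃ λ i → Dist≤ G ℓ (C s i) (α s) ⊎ Dist≤ G ℓ (C (suc s) i) (α s)
        found {s} α ¬h with seen? G ℓ (C s) (α s) | seen? G ℓ (C (suc s)) (α s)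
        ... | inj₁ (i , d) | _            = i , inj₁ d
        ... | inj₂ _       | inj₁ (i , d) = i , inj₂ d
        ... | inj₂ u       | inj₂ u′      = contradiction (u , u′) ¬h

        scheduled-sees : Eventually (Dist≤ G ℓ) init
        scheduled-sees
          with Reach-trace (hidden? C) (λ t → rob (run init t)) (λ t → RobberStrategy.legal ρ _ _) T
        ... | inj₁ r = contradiction (_ , r) (dead _)
        ... | inj₂ (s , ¬h) with found {s} (λ t → rob (run init t)) ¬h
        ... | i , inj₁ d =
          s , i , inj₁ (subst (λ c → Dist≤ G ℓ c (rob (run init s))) (sym (on-schedule s i)) d)
        ... | i , inj₂ d =
          s , i , inj₂ (subst (λ c → Dist≤ G ℓ c (rob (run init s))) (sym (on-schedule (suc s) i)) d)

    -- The schedule that a strategy follows while it sees nothing.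

    module _ (σ : CopStrategy G k) where
      silence : ℕ → List (Maybe (V G))
      silence zero    = nothing ∷ []
      silence (suc t) = nothing ∷ nothing ∷ silence t

      blind : ℕ → Conf G k
      blind zero    = CopStrategy.start σ
      blind (suc t) = CopStrategy.move σ (silence t) (blind t)

      module _ (α : ℕ → V G) (steps : ∀ t → Step G (α t) (α (suc t))) where

        walker : RobberStrategy G k
        walker = record
          { start = λ _ → α 0
          -- At the robber's move number `t + 1` the history holds `t + 2` configurations: the
          -- initial one and `t + 1` cop moves.
          ; move  = λ h → follow α (pred (pred (length h)))
          ; legal = λ h → follow-legal α steps (pred (pred (length h)))
          }

        open Play G ℓ σ walker
        open State

        record Blind (t : ℕ) (s : State G k) : Set where
          field
            cops≡ : cops s ≡ blind t
            rob≡  : rob s ≡ α t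
            copH≡ : copH s ≡ silence t
            time  : length (robH s) ≡ suc t

        blind-round : ∀ {t s} → Blind t s → Hidden blind t (α t) → Unseen G ℓ (blind (suc t)) (α (suc t)) →
                      Blind (suc t) (round s)
        blind-round {t} {st _ _ _ H} record { cops≡ = refl ; rob≡ = refl ; copH≡ = refl ; time = time }
                    (_ , un) un′ = record
          { cops≡ = refl
          ; rob≡  = rob≡
          ; copH≡ = cong₂ _∷_ (trans (cong (observe G ℓ (blind (suc t))) rob≡)
                                     (observe-nothing G ℓ (blind (suc t)) _ un′))
                              (cong (_∷ silence t) (observe-nothing G ℓ (blind (suc t)) _ un))
          ; time  = cong suc time
          }
          where
          rob≡ : follow α (pred (length H)) (α t) ≡ α (suc t)
          rob≡ rewrite time = follow-on α t refl

        blind-run : ∀ t → (∃ λ s → ¬ Hidden blind s (α s)) ⊎ Blind t (run init t)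
        blind-run zero with unseen? G ℓ (blind 0) (α 0)
        ... | no seen = inj₁ (0 , λ (un , _) → seen un)
        ... | yes un  = inj₂ record
          { cops≡ = refl
          ; rob≡  = refl
          ; copH≡ = cong (_∷ []) (observe-nothing G ℓ (blind 0) _ un)
          ; time  = refl
          }
        blind-run (suc t) with blind-run t | hidden? blind t (α t) | unseen? G ℓ (blind (suc t)) (α (suc t))
        ... | inj₁ e | _     | _       = inj₁ e
        ... | inj₂ _ | no ¬h | _       = inj₁ (t , ¬h)
        ... | inj₂ _ | yes _ | no seen = inj₁ (suc t , λ (un , _) → seen un)
        ... | inj₂ b | yes h | yes un  = inj₂ (blind-round b h un)

        walker-found : Eventually (Dist≤ G ℓ) init → ∃ λ s → ¬ Hidden blind s (α s)
        walker-found (t , i , e) with blind-run t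
        ... | inj₁ found = found
        ... | inj₂ record { cops≡ = cops≡ ; rob≡ = rob≡ ; copH≡ = copH≡ } with e
        ... | inj₁ d = t , λ (un , _) → un i (subst₂ (λ C r → Dist≤ G ℓ (C i) r) cops≡ rob≡ d)
        ... | inj₂ d = t , λ (_ , un) → un i (subst₂ (λ C r → Dist≤ G ℓ (C i) r)
                                                 (cong₂ (CopStrategy.move σ) copH≡ cops≡) rob≡ d)

      -- Every infinite walk is played by some `walker`, which `σ` finds. The fan theorem turns this
      -- into a time bound for each starting vertex, and finitely many vertices have a common bound.
      blind-clears : (∀ ρ → Play.Eventually G ℓ σ ρ (Dist≤ G ℓ) (Play.init G ℓ σ ρ)) → Clears blind
      blind-clears win = (λ t i → CopStrategy.legal σ (silence t) (blind t) i) ,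
        uniform-bound (λ x T → ¬ Alive (Hidden blind) T x)
          (λ x s≤t ¬a a → ¬a (Alive-antitone {Hidden blind} s≤t a))
          (λ x → escapeless⇒mortal n (hidden? blind) x (λ t → count≤size (hidden? blind t))
                   (λ α _ steps → walker-found α steps (win (walker α steps))))

    -- Codes for pairs of a set of vertices (where the robber may be) and a cop configuration.
    Code : Set
    Code = Fin (2 ^ n * n ^ k)

    Suspect : Code → V G → Set
    Suspect q x = finToFun {2} {n} (proj₁ (remQuot {2 ^ n} (n ^ k) q)) x ≡ suc zero

    conf : Code → Conf G k
    conf q = finToFun (proj₂ (remQuot {2 ^ n} (n ^ k) q))

    suspect? : ∀ q x → Dec (Suspect q x)
    suspect? q x = _ ≟ suc zero

    code : {S : V G → Set} → (∀ x → Dec (S x)) → Conf G k → Code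
    code S? C = combine (funToFin (λ x → bit (S? x))) (funToFin C)

    module _ {S : V G → Set} (S? : ∀ x → Dec (S x)) (C : Conf G k) where

      decode : remQuot {2 ^ n} (n ^ k) (code S? C) ≡ (funToFin (λ x → bit (S? x)) , funToFin C)
      decode = remQuot-combine {2 ^ n} {n ^ k} (funToFin (λ x → bit (S? x))) (funToFin C)

      code-bit : ∀ x → finToFun {2} {n} (proj₁ (remQuot {2 ^ n} (n ^ k) (code S? C))) x ≡ bit (S? x)
      code-bit x = trans
        (cong (λ p → finToFun {2} {n} (proj₁ p) x) decode)
        (finToFun-funToFin (λ x → bit (S? x)) x)

      suspect-code⁺ : ∀ x → S x → Suspect (code S? C) x
      suspect-code⁺ x s = trans (code-bit x) (bit⁺ (S? x) s)

      suspect-code⁻ : ∀ x → Suspect (code S? C) x → S x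
      suspect-code⁻ x s = bit⁻ (S? x) (trans (sym (code-bit x)) s)

      conf-code : ∀ i → conf (code S? C) i ≡ C i
      conf-code i = trans
        (cong (λ p → finToFun (proj₂ p) i) decode)
        (finToFun-funToFin C i)

      unseen-code⁻ : ∀ x → Unseen G ℓ (conf (code S? C)) x → Unseen G ℓ C x
      unseen-code⁻ x un i = subst (λ c → ¬ Dist≤ G ℓ c x) (conf-code i) (un i)

    -- Only an inclusion is demanded of the new suspects. Overestimating them is sound, since a
    -- `Clean` code still certifies that no robber is left.
    _⟶_ : Code → Code → Set
    q ⟶ q′ = (∀ i → Step G (conf q i) (conf q′ i)) ×
             (∀ x y → Suspect q x × Unseen G ℓ (conf q) x × Unseen G ℓ (conf q′) x × Step G x y → Suspect q′ y)

    _⟶?_ : Decidable _⟶_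
    q ⟶? q′ = all? (λ i → step? G (conf q i) (conf q′ i)) ×-dec
      all? (λ x → all? (λ y →
        (suspect? q x ×-dec unseen? G ℓ (conf q) x ×-dec unseen? G ℓ (conf q′) x ×-dec step? G x y)
          →-dec suspect? q′ y))

    Clean : Code → Set
    Clean q = ∀ x → ¬ Suspect q x

    Clearable : Set
    Clearable = ∃ λ q → (∀ x → Suspect q x) × ∃ λ q′ → Star _⟶_ q q′ × Clean q′

    clearable? : Dec Clearable
    clearable? = any? (λ q → all? (suspect? q) ×-dec
      any? (λ q′ → star? _⟶?_ q q′ ×-dec all? (λ x → ¬? (suspect? q′ x))))

    -- The cops stand still once the walk of codes has ended.
    schedule : ∀ {q q′} → Star _⟶_ q q′ → ℕ → Conf G k
    schedule {q} w       zero    = conf q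
    schedule {q} ε       (suc t) = conf q
    schedule     (_ ◅ w) (suc t) = schedule w t

    schedule-legal : ∀ {q q′} (w : Star _⟶_ q q′) t i → Step G (schedule w t i) (schedule w (suc t) i)
    schedule-legal ε zero    i = inj₁ refl
    schedule-legal ε (suc t) i = inj₁ refl
    schedule-legal ((s , _) ◅ ε)       zero i = s i
    schedule-legal ((s , _) ◅ (_ ◅ _)) zero i = s i
    schedule-legal (_ ◅ w) (suc t) i = schedule-legal w t i

    schedule-zero : ∀ {q q′} (w : Star _⟶_ q q′) → schedule w 0 ≡ conf q
    schedule-zero ε       = refl
    schedule-zero (_ ◅ _) = refl

    -- Along the walk a robber that is still hidden stays among the suspects; `T` is the length of
    -- the walk.
    schedule-clears : ∀ {q q′} (w : Star _⟶_ q q′) → Clean q′ →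
                      ∃ λ T → ∀ x → Suspect q x → ¬ Alive (Hidden (schedule w)) T x
    schedule-clears ε clean = 0 , λ x s → contradiction s (clean x)
    schedule-clears {q} w@((_ , spread) ◅ w′) clean with schedule-clears w′ clean
    ... | T , dead = suc T , λ x s (v , r) →
      let y , x→y , r′ = Reach-uncons {Hidden (schedule w)} T r
          un , un′ = Reach-start {Hidden (schedule w)} (suc T) r
      in dead y (spread x y (s , un , subst (λ C → Unseen G ℓ C x) (schedule-zero w′) un′ , x→y)) (v , r′)

    -- Conversely, a clearing schedule is turned into a walk of codes by updating the suspect set
    -- `S` exactly.
    sweep : ∀ T (C : ℕ → Conf G k) → (∀ t i → Step G (C t i) (C (suc t) i)) →
            ∀ {S : V G → Set} (S? : ∀ x → Dec (S x)) → (∀ x → S x → ¬ Alive (Hidden C) T x) →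
            ∃ λ q′ → Star _⟶_ (code S? (C 0)) q′ × Clean q′
    sweep T C legal {S} S? dead = continue T dead
      where
      S′ : V G → Set
      S′ y = ∃ λ x → (S x × Hidden C 0 x) × Step G x y

      S′? : ∀ y → Dec (S′ y)
      S′? y = any? (λ x → (S? x ×-dec hidden? C 0 x) ×-dec step? G x y)

      first : code S? (C 0) ⟶ code S′? (C 1)
      first =
        (λ i → subst₂ (Step G) (sym (conf-code S? (C 0) i)) (sym (conf-code S′? (C 1) i)) (legal 0 i)) ,
        (λ x y (s , un , un′ , x→y) → suspect-code⁺ S′? (C 1) y
          (x , (suspect-code⁻ S? (C 0) x s , unseen-code⁻ S? (C 0) x un ,
            unseen-code⁻ S′? (C 1) x un′) , x→y))

      continue : ∀ T → (∀ x → S x → ¬ Alive (Hidden C) T x) → ∃ λ q′ → Star _⟶_ (code S? (C 0)) q′ × Clean q′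
      -- No vertex of `S` is hidden at time 0, so one more step empties the set; the walk has
      -- `T + 1` steps in all.
      continue zero dead = _ , first ◅ ε , λ y s →
        let x , (Sx , h) , _ = suspect-code⁻ S′? (C 1) y s in dead x Sx (x , h , refl)
      continue (suc T) dead =
        let q′ , w , clean = sweep T (λ t → C (suc t)) (λ t → legal (suc t)) S′?
              (λ y (x , (Sx , h) , x→y) (v , r) → dead x Sx (v , Reach-cons {Hidden C} T h x→y r))
        in q′ , first ◅ w , clean

    canSee? : Dec (CanSee G ℓ k)
    canSee? = map′ to from clearable?
      where
      to : Clearable → CanSee G ℓ k
      to (q , all , q′ , w , clean) =
        let T , dead = schedule-clears w clean
            clears = schedule-legal w , T , λ x → dead x (all x)
        in scheduled clears , scheduled-sees clears

      from : CanSee G ℓ k → Clearable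
      from (σ , win) =
        let legal , T , dead = blind-clears σ win
            -- The full set of vertices is encoded as the constant predicate `V G`, with `x` as its
            -- own witness.
            q′ , w , clean = sweep T (blind σ) legal {λ _ → V G} (λ x → yes x) (λ x _ → dead x)
        in _ , (λ x → suspect-code⁺ (λ x → yes x) (blind σ 0) x x) , q′ , w , clean

  -- The least number of cops.

  canSee-everywhere : ∀ ℓ → CanSee G ℓ n
  canSee-everywhere ℓ =
    record { start = λ x → x ; move = λ _ C → C ; legal = λ _ _ _ → inj₁ refl } ,
    λ ρ → 0 , _ , inj₁ (Dist≤-refl G ℓ _)

  least : {P : ℕ → Set} → (∀ j → Dec (P j)) → ∀ m → P m → ∃ (IsLeast G P)
  least {P} P? m p = scan m 0 (λ _ ()) (subst P (sym (+-identityʳ m)) p)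
    where
    scan : ∀ d b → (∀ j → j < b → ¬ P j) → P (d + b) → ∃ (IsLeast G P)
    scan d b below p with P? b
    ... | yes pb = b , pb , below
    scan zero b below p | no ¬pb = contradiction p ¬pb
    scan (suc d) b below p | no ¬pb = scan d (suc b) below′ (subst P (sym (+-suc d b)) p)
      where
      below′ : ∀ j → j < suc b → ¬ P j
      below′ j j<1+b with m<1+n⇒m<n∨m≡n j<1+b
      ... | inj₁ j<b  = below j j<b
      ... | inj₂ refl = ¬pb

theorem4p2 : (G : Graph) → 0 < Graph.n G → Connected G → Chordal G → (ℓ : ℕ) →
    Σ ℕ (λ m → IsLeast G (CanCapture G ℓ) m × IsLeast G (CanSee G ℓ) m)
    × ((u r : V G) → Dist≤ G ℓ u r →
    OneCopCapturesCopsTurn G ℓ u r × OneCopCapturesRobbersTurn G ℓ u r)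
theorem4p2 G _ connected chordal ℓ =
  -- The minimum is sought for seeing, which is decidable. It carries over to capturing because the
  -- two are equivalent for each number of cops.
  (let m , see , below = least G (λ k → canSee? G ℓ {k}) (Graph.n G) (canSee-everywhere G ℓ)
   in m , (see⇒capture G connected chordal ℓ m see ,
           λ j j<m win → below j j<m (capture⇒see G ℓ j win)) , see , below) ,
  λ u r d → captures-cops-turn G connected chordal ℓ u r d , captures-robbers-turn G connected chordal ℓ u r d
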